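{- Let $G$ be a nice graph with maximum degree $\Delta$, let $r$ be an even nonnegative integer, and let $v\in V(G)$ be a node such that inside the $r$-radius neighborhood of $v$ there are no degree-choosable components and every node has degree $\Delta$. Then there are at least $(\Delta-1)^{r/2}$ nodes at distance $r$ from $v$.
   Context: Graphs are finite, simple and undirected. A nice graph is a connected graph that is neither a path, a cycle, nor a clique (so its maximum degree is at least $3$). A degree-choosable component (DCC) of $G$ is a node-induced subgraph of $G$ that is 2-connected and is neither a clique nor an odd cycle. The $r$-radius neighborhood of $v$ is the set of nodes at distance at most $r$ from $v$; a DCC lies inside it if all its nodes do. -}

module Defs where

open import Data.Nat using (ℕ; zero; suc; _+_; _≤_; _<_)
open import Data.Nat.Properties using (_≟_; allUpTo?; 1+n≢n)
open import Data.Nat.Divisibility using (_∣_)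
open import Data.Fin using (Fin; toℕ; fromℕ) renaming (zero to fzero)
open import Data.Fin.Properties using (any?) renaming (_≟_ to _≟ᶠ_)
open import Data.Fin.Subset using (Subset; _∈_)
open import Data.List using (List; length; filter; map; allFin)
open import Data.List.Extrema.Nat using (max)
open import Data.Product using (Σ; ∃; _×_; _,_; proj₁)
open import Data.Sum using (_⊎_; inj₁; inj₂; swap)
open import Function.Bundles using (_↔_; _↣_; _⇔_; module Inverse)
open import Level using (0ℓ)
open import Relation.Binary using (Rel; Symmetric; Irreflexive; Decidable)
open import Relation.Binary.PropositionalEquality using (_≡_; _≢_; refl; sym)
open import Relation.Nullary using (¬_; Dec)
open import Relation.Nullary.Decidable using (_×-dec_; _⊎-dec_; ¬?; map′)
open import Relation.Unary using (Pred)

-- Simple undirected graphs; finite ones have vertex type Fin n.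
record Graph (V : Set) : Set₁ where
  field
    _~_      : Rel V 0ℓ
    ~-sym    : Symmetric _~_
    ~-irrefl : Irreflexive _≡_ _~_
    _~?_     : Decidable _~_

open Graph public using () renaming (_~_ to Adj; _~?_ to adj?)

private
  variable
    V W : Set
    n : ℕ

induce : Graph V → (P : Pred V 0ℓ) → Graph (Σ V P)
induce G P = record
  { _~_      = λ x y → proj₁ x ~ proj₁ y
  ; ~-sym    = ~-sym
  ; ~-irrefl = λ { refl → ~-irrefl refl }
  ; _~?_     = λ x y → proj₁ x ~? proj₁ y
  }
  where open Graph G

_[_] : Graph (Fin n) → (S : Subset n) → Graph (Σ (Fin n) (_∈ S))
G [ S ] = induce G (_∈ S)

_-_ : Graph V → (x : V) → Graph (Σ V (_≢ x))
G - x = induce G (_≢ x)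

_≅_ : Graph V → Graph W → Set
_≅_ {V} {W} G H = Σ (V ↔ W) λ f →
  ∀ x y → Adj G x y ⇔ Adj H (Inverse.to f x) (Inverse.to f y)

pathGraph : ∀ k → Graph (Fin k)
pathGraph k = record
  { _~_      = λ i j → toℕ j ≡ suc (toℕ i) ⊎ toℕ i ≡ suc (toℕ j)
  ; ~-sym    = swap
  ; ~-irrefl = λ { refl (inj₁ e) → 1+n≢n (sym e) ; refl (inj₂ e) → 1+n≢n (sym e) }
  ; _~?_     = λ i j → (toℕ j ≟ suc (toℕ i)) ⊎-dec (toℕ i ≟ suc (toℕ j))
  }

-- The cycle on 3 + k vertices: the path together with the edge joining its
-- first and last vertices.
cycleGraph : ∀ k → Graph (Fin (3 + k))
cycleGraph k = record
  { _~_      = λ i j → (i ~ j) ⊎ (Ends i j ⊎ Ends j i)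
  ; ~-sym    = λ { (inj₁ e) → inj₁ (~-sym e) ; (inj₂ e) → inj₂ (swap e) }
  ; ~-irrefl = λ { refl (inj₁ e)                  → ~-irrefl refl e
                 ; refl (inj₂ (inj₁ (refl , ())))
                 ; refl (inj₂ (inj₂ (refl , ()))) }
  ; _~?_     = λ i j → (i ~? j) ⊎-dec (ends? i j ⊎-dec ends? j i)
  }
  where
  open Graph (pathGraph (3 + k))
  Ends : Rel (Fin (3 + k)) 0ℓ
  Ends i j = i ≡ fzero × j ≡ fromℕ (2 + k)
  ends? : Decidable Ends
  ends? i j = (i ≟ᶠ fzero) ×-dec (j ≟ᶠ fromℕ (2 + k))

IsPath IsCycle IsOddCycle IsClique : Graph V → Set
IsPath     G = ∃ λ k → G ≅ pathGraph k
IsCycle    G = ∃ λ k → G ≅ cycleGraph k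
IsOddCycle G = ∃ λ k → ¬ (2 ∣ 3 + k) × G ≅ cycleGraph k
IsClique   G = ∀ x y → x ≢ y → Adj G x y

data Walk (G : Graph V) : V → V → ℕ → Set where
  []  : ∀ {x} → Walk G x x 0
  _∷_ : ∀ {x y z ℓ} → Adj G x y → Walk G y z ℓ → Walk G x z (suc ℓ)

Connected : Graph V → Set
Connected G = ∀ x y → ∃ λ ℓ → Walk G x y ℓ

-- Whether a single edge counts as 2-connected is immaterial for IsDCC below,
-- since an edge is a clique.
TwoConnected : Graph V → Set
TwoConnected {V} G = (Fin 3 ↣ V) × Connected G × (∀ x → Connected (G - x))

Distance : Graph V → V → V → ℕ → Set
Distance G x y d = Walk G x y d × (∀ {ℓ} → ℓ < d → ¬ Walk G x y ℓ)

Ball : Graph V → V → ℕ → Pred V 0ℓ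
Ball G v r x = ∃ λ d → d ≤ r × Distance G v x d

walk? : (G : Graph (Fin n)) → ∀ x y ℓ → Dec (Walk G x y ℓ)
walk? G x y zero    = map′ (λ { refl → [] }) (λ { [] → refl }) (x ≟ᶠ y)
walk? G x y (suc ℓ) = map′ (λ { (_ , e , w) → e ∷ w }) (λ { (e ∷ w) → _ , e , w })
                        (any? λ z → adj? G x z ×-dec walk? G z y ℓ)

distance? : (G : Graph (Fin n)) → ∀ x y d → Dec (Distance G x y d)
distance? G x y d = walk? G x y d ×-dec allUpTo? (λ ℓ → ¬? (walk? G x y ℓ)) d

sphere : Graph (Fin n) → Fin n → ℕ → List (Fin n)
sphere G v r = filter (λ x → distance? G v x r) (allFin _)

degree : Graph (Fin n) → Fin n → ℕ
degree G x = length (filter (adj? G x) (allFin _))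

maxDegree : Graph (Fin n) → ℕ
maxDegree G = max 0 (map (degree G) (allFin _))

Nice : Graph V → Set
Nice G = Connected G × ¬ IsPath G × ¬ IsCycle G × ¬ IsClique G

IsDCC : Graph (Fin n) → Subset n → Set
IsDCC G S = TwoConnected (G [ S ]) × ¬ IsClique (G [ S ]) × ¬ IsOddCycle (G [ S ])

-- In the breadth-first layering around v, let Δ be the common degree.  A vertex of the ball with two
-- parents would lie on an even cycle together with a vertex two levels above it, a degree-choosable
-- component; so parents are unique.  An edge inside a level closes an odd cycle through tree edges, and
-- two such cycles sharing an edge have a 2-connected union with a vertex of degree 3, hence form a
-- clique.  Consequently a vertex without children forces G to be K_{Δ+1}, or a cycle when Δ = 2, and
-- counting downward edges gives every vertex at least Δ - 1 grandchildren.
module Submission where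

open import Defs
open import Data.Nat using (ℕ; zero; suc; _+_; _*_; _∸_; _^_; _≤_; _<_; _/_; z≤n; s≤s; s≤s⁻¹; z<s)
open import Data.Nat.Properties as ℕ using ()
open import Data.Nat.DivMod using (m*n/n≡m)
open import Data.Nat.Divisibility using (_∣_; divides)
open import Data.Fin using (Fin; zero; suc; toℕ; fromℕ; fromℕ<; inject₁)
open import Data.Fin.Properties as Fin using (any?; _≟_; toℕ-injective; toℕ-fromℕ; toℕ-fromℕ<; toℕ≤pred[n])
open import Data.Fin.Subset using (Subset; _∈_; _∪_)
open import Data.Fin.Subset.Properties using (x∈p∪q⁺; x∈p∪q⁻)
open import Data.List using (List; []; _∷_; _++_; length; map; filter; concatMap; allFin)
open import Data.List.Membership.Propositional using (find) renaming (_∈_ to _∈ˡ_)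
open import Data.List.Membership.Propositional.Properties
  using (∈-∃++; ∈-++⁺ˡ; ∈-++⁺ʳ; ∈-++⁻; ∈-filter⁺; ∈-filter⁻; ∈-map⁻; ∈-concatMap⁻; ∈-allFin; ∈-length)
open import Data.List.Properties using (length-++; length-map)
open import Data.List.Relation.Unary.All as All using (All; []; _∷_)
open import Data.List.Relation.Unary.AllPairs using ([]; _∷_)
open import Data.List.Relation.Unary.Any as Any using (here; there)
open import Data.List.Relation.Unary.Unique.Propositional using (Unique)
open import Data.List.Relation.Unary.Unique.Propositional.Properties using (++⁺; filter⁺; allFin⁺)
open import Data.Product using (Σ; ∃; _×_; _,_; proj₁; proj₂)
open import Data.Sum using (_⊎_; inj₁; inj₂; [_,_]′)
open import Data.Vec using (tabulate)
open import Data.Vec.Properties using (lookup∘tabulate; lookup⇒[]=; []=⇒lookup)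
open import Data.Vec.Properties.WithK using ([]=-irrelevant)
open import Function using (_∘_; id)
open import Function.Bundles using (mk↔ₛ′; mk⇔; mk↣; module Inverse; module Equivalence; module Injection)
open import Function.Properties.Inverse using (↔⇒↣; ↔-sym)
open import Level using (0ℓ)
open import Relation.Binary.Definitions using (tri<; tri≈; tri>)
open import Relation.Binary.Construct.Closure.ReflexiveTransitive as Star using (Star; ε; _◅_; _◅◅_)
open import Relation.Binary.PropositionalEquality
  using (_≡_; _≢_; refl; sym; trans; cong; subst; subst₂)
open import Relation.Nullary using (¬_; Dec; yes; no; does; contradiction)
open import Relation.Nullary.Decidable using (_×-dec_; dec-true)
open import Relation.Unary using (Pred; Decidable)

-- Growth has to be counted over two levels, because a single level need not grow: a vertex in a
-- clique with its parent and `Δ - 2` siblings has only one child. The loss does not occur twice in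
-- a row. If `p` has a neighbour on its own level, the same-level neighbours of a child `u` of `p`
-- are siblings of `u`, so their children are grandchildren of `p` as well. Three facts carry the
-- structural part. Adjacent vertices differ by at most one level, so a clique cannot contain a
-- vertex together with one two levels above it. Two 2-connected sets with two common vertices have
-- a 2-connected union. Every cycle that is built runs upwards from its lowest vertices to a common
-- ancestor, so it stays in the ball as soon as these vertices lie in it.

private
  variable
    A B : Set
    n : ℕ

-- Counting with duplicate-free lists and decidable subsets.

length-⊆ : {xs ys : List A} → Unique xs → (∀ {x} → x ∈ˡ xs → x ∈ˡ ys) → length xs ≤ length ys
length-⊆ {xs = []}     _          _   = z≤n
length-⊆ {xs = x ∷ xs} (x∉ ∷ uxs) sub with ∈-∃++ (sub (here refl))
... | as , bs , refl = subst (suc (length xs) ≤_) (sym length-middle) (s≤s (length-⊆ uxs sub-rest))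
  where
  length-middle : length (as ++ x ∷ bs) ≡ suc (length (as ++ bs))
  length-middle = trans (length-++ as) (trans (ℕ.+-suc (length as) (length bs)) (cong suc (sym (length-++ as))))
  sub-rest : ∀ {y} → y ∈ˡ xs → y ∈ˡ as ++ bs
  sub-rest y∈ with ∈-++⁻ as (sub (there y∈))
  ... | inj₁ y∈as         = ∈-++⁺ˡ y∈as
  ... | inj₂ (here refl)  = contradiction refl (All.lookup x∉ y∈)
  ... | inj₂ (there y∈bs) = ∈-++⁺ʳ as y∈bs

-- The left inverse is demanded only on the list, because `parent` is known to undo `child` only at
-- levels below `r`.
map-unique : (f : A → B) (g : B → A) {xs : List A} → (∀ {x} → x ∈ˡ xs → g (f x) ≡ x) →
             Unique xs → Unique (map f xs)
map-unique f g inv []        = []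
map-unique f g {x ∷ xs} inv (x∉ ∷ uxs) = All.tabulate fx∉ ∷ map-unique f g (inv ∘ there) uxs
  where
  fx∉ : ∀ {y} → y ∈ˡ map f xs → f x ≢ y
  fx∉ y∈ refl with ∈-map⁻ f y∈
  ... | z , z∈ , eq =
    All.lookup x∉ z∈ (trans (sym (inv (here refl))) (trans (cong g eq) (inv (there z∈))))

∃-other : {xs : List (Fin n)} → Unique xs → 2 ≤ length xs → ∀ x → ∃ λ y → y ∈ˡ xs × y ≢ x
∃-other {xs = y ∷ z ∷ _} ((y≢z ∷ _) ∷ _) _ x with y ≟ x
... | no y≢x    = y , here refl , y≢x
... | yes refl  = z , there (here refl) , y≢z ∘ sym
∃-other {xs = _ ∷ []} _ (s≤s ()) _

∃-∈ : {xs : List A} → 1 ≤ length xs → ∃ (_∈ˡ xs)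
∃-∈ {xs = x ∷ _} _ = x , here refl

-- As `h` sends every element of `g x` back to `x`, the lists `g x` are pairwise disjoint and their
-- lengths add up. In the growth step `h` is the grandparent map.
concatMap-fibres : (h : B → A) (g : A → List B) (k : ℕ) {xs : List A} → Unique xs →
                   (∀ {x} → x ∈ˡ xs → Unique (g x) × k ≤ length (g x) × (∀ {y} → y ∈ˡ g x → h y ≡ x)) →
                   Unique (concatMap g xs) × k * length xs ≤ length (concatMap g xs)
concatMap-fibres h g k [] _ = [] , ℕ.≤-reflexive (ℕ.*-zeroʳ k)
concatMap-fibres h g k {x ∷ xs} (x∉ ∷ uxs) fib
  with fib (here refl) | concatMap-fibres h g k uxs (fib ∘ there)
... | ugx , k≤ , hgx | urest , le =
  ++⁺ ugx urest disjoint ,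
  subst₂ _≤_ (sym (ℕ.*-suc k (length xs))) (sym (length-++ (g x))) (ℕ.+-mono-≤ k≤ le)
  where
  disjoint : ∀ {y} → ¬ (y ∈ˡ g x × y ∈ˡ concatMap g xs)
  disjoint (y∈ , y∈′) with find (∈-concatMap⁻ g {xs = xs} y∈′)
  ... | z , z∈ , y∈gz =
    All.lookup x∉ z∈ (trans (sym (hgx y∈)) (proj₂ (proj₂ (fib (there z∈))) y∈gz))

module _ {P : Pred (Fin n) 0ℓ} (P? : Decidable P) where

  select : List (Fin n)
  select = filter P? (allFin n)

  ∈-select⁺ : ∀ {x} → P x → x ∈ˡ select
  ∈-select⁺ {x} = ∈-filter⁺ P? (∈-allFin x)

  ∈-select⁻ : ∀ {x} → x ∈ˡ select → P x
  ∈-select⁻ = proj₂ ∘ ∈-filter⁻ P? {xs = allFin n}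

  select-unique : Unique select
  select-unique = filter⁺ P? (allFin⁺ n)

  subset : Subset n
  subset = tabulate (does ∘ P?)

  ∈-subset⁺ : ∀ {x} → P x → x ∈ subset
  ∈-subset⁺ {x} px = lookup⇒[]= x subset (trans (lookup∘tabulate (does ∘ P?) x) (dec-true (P? x) px))

  ∈-subset⁻ : ∀ {x} → x ∈ subset → P x
  ∈-subset⁻ {x} x∈ with P? x | trans (sym (lookup∘tabulate (does ∘ P?) x)) ([]=⇒lookup x∈)
  ... | yes px | _  = px
  ... | no _   | ()


-- The cyclic successor on the standard cycle.

module _ (k : ℕ) where

  -- Orienting the cycle makes adjacency a partial bijection and its converse, so that statements
  -- about degrees reduce to functionality and injectivity.
  Next : Fin (3 + k) → Fin (3 + k) → Set
  Next i j = toℕ j ≡ suc (toℕ i) ⊎ (toℕ i ≡ 2 + k × toℕ j ≡ 0)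

  private
    last-≢ : {i j : Fin (3 + k)} → toℕ i ≡ 2 + k → toℕ j ≢ suc (toℕ i)
    last-≢ {j = j} i≡ j≡ = ℕ.<-irrefl (trans j≡ (cong suc i≡)) (Fin.toℕ<n j)

  next-functional : ∀ {i j₁ j₂} → Next i j₁ → Next i j₂ → j₁ ≡ j₂
  next-functional (inj₁ p)       (inj₁ q)       = toℕ-injective (trans p (sym q))
  next-functional {i} {j₁} (inj₁ p)       (inj₂ (q , _)) = contradiction p (last-≢ {i} {j₁} q)
  next-functional {i} {_} {j₂} (inj₂ (p , _)) (inj₁ q)       = contradiction q (last-≢ {i} {j₂} p)
  next-functional (inj₂ (_ , p)) (inj₂ (_ , q)) = toℕ-injective (trans p (sym q))

  next-injective : ∀ {i₁ i₂ j} → Next i₁ j → Next i₂ j → i₁ ≡ i₂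
  next-injective (inj₁ p)       (inj₁ q)       = toℕ-injective (ℕ.suc-injective (trans (sym p) q))
  next-injective (inj₁ p)       (inj₂ (_ , q)) with () ← trans (sym p) q
  next-injective (inj₂ (_ , p)) (inj₁ q)       with () ← trans (sym p) q
  next-injective (inj₂ (p , _)) (inj₂ (q , _)) = toℕ-injective (trans p (sym q))

  cycle-adj⇒next : ∀ {i j} → Adj (cycleGraph k) i j → Next i j ⊎ Next j i
  cycle-adj⇒next (inj₁ (inj₁ p))              = inj₁ (inj₁ p)
  cycle-adj⇒next (inj₁ (inj₂ p))              = inj₂ (inj₁ p)
  cycle-adj⇒next (inj₂ (inj₁ (refl , refl))) = inj₂ (inj₂ (toℕ-fromℕ (2 + k) , refl))
  cycle-adj⇒next (inj₂ (inj₂ (refl , refl))) = inj₁ (inj₂ (toℕ-fromℕ (2 + k) , refl))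

  next⇒cycle-adj : ∀ {i j} → Next i j → Adj (cycleGraph k) i j
  next⇒cycle-adj (inj₁ p)       = inj₁ (inj₁ p)
  next⇒cycle-adj (inj₂ (p , q)) =
    inj₂ (inj₂ (toℕ-injective q , toℕ-injective (trans p (sym (toℕ-fromℕ (2 + k))))))

  -- Of three neighbours two lie on the same side of `i`: both are successors or both are
  -- predecessors.
  cycle-degree≤2 : ∀ {i a b c} → Adj (cycleGraph k) i a → Adj (cycleGraph k) i b →
                   Adj (cycleGraph k) i c → a ≡ b ⊎ a ≡ c ⊎ b ≡ c
  cycle-degree≤2 p q r with cycle-adj⇒next p | cycle-adj⇒next q | cycle-adj⇒next r
  ... | inj₁ p | inj₁ q | _      = inj₁ (next-functional p q)
  ... | inj₁ p | inj₂ _ | inj₁ r = inj₂ (inj₁ (next-functional p r))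
  ... | inj₁ _ | inj₂ q | inj₂ r = inj₂ (inj₂ (next-injective q r))
  ... | inj₂ p | inj₂ q | _      = inj₁ (next-injective p q)
  ... | inj₂ p | inj₁ _ | inj₂ r = inj₂ (inj₁ (next-injective p r))
  ... | inj₂ _ | inj₁ q | inj₁ r = inj₂ (inj₂ (next-functional q r))

  ∃-next : ∀ i → ∃ (Next i)
  ∃-next i with toℕ i ℕ.<? 2 + k
  ... | yes i< = fromℕ< (s≤s i<) , inj₁ (toℕ-fromℕ< (s≤s i<))
  ... | no i≮  = zero , inj₂ (ℕ.≤-antisym (toℕ≤pred[n] i) (ℕ.≮⇒≥ i≮) , refl)

  ∃-prev : ∀ i → ∃ λ j → Next j i
  ∃-prev zero    = fromℕ (2 + k) , inj₂ (toℕ-fromℕ (2 + k) , refl)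
  ∃-prev (suc i) = inject₁ i , inj₁ (cong suc (sym (Fin.toℕ-inject₁ i)))

  -- This depends on the length being at least 3. It keeps the two cycle neighbours of a vertex
  -- distinct in `cycle⇒IsCycle`.
  next-asym : ∀ {i j} → Next i j → ¬ Next j i
  next-asym {i} (inj₁ p)       (inj₁ q)       = ℕ.<-irrefl (trans q (cong suc p)) (ℕ.m≤n⇒m≤1+n ℕ.≤-refl)
  next-asym (inj₁ p)       (inj₂ (q , r)) with () ← trans (sym q) (trans p (cong suc r))
  next-asym (inj₂ (p , q)) (inj₁ r)       with () ← trans (sym p) (trans r (cong suc q))
  next-asym (inj₂ (p , q)) (inj₂ (r , _)) with () ← trans (sym q) r

-- 2-connected vertex sets and their unions.

module _ (G : Graph (Fin n)) where
  open Graph G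

  -- Paths live on the vertices of `G`, without membership proofs in the vertex type, so they can be
  -- enlarged, reversed and concatenated freely; `joined-walk` carries them over to induced graphs.
  Joined : Pred (Fin n) 0ℓ → Fin n → Fin n → Set
  Joined P = Star (λ x y → x ~ y × P x × P y)

  Joined-sym : ∀ {P x y} → Joined P x y → Joined P y x
  Joined-sym = Star.reverse (λ (e , px , py) → ~-sym e , py , px)

  Joined-mono : ∀ {P Q : Pred (Fin n) 0ℓ} {x y} → (∀ {z} → P z → Q z) → Joined P x y → Joined Q x y
  Joined-mono sub = Star.map (λ (e , px , py) → e , sub px , sub py)

  -- The deleted vertex `x` of `avoid` ranges over all of `G`. Plain connectivity follows, since one
  -- of `a`, `b`, `c` differs from both end points and can be deleted.
  record Biconnected (S : Subset n) : Set where
    field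
      {a b c}     : Fin n
      a∈S         : a ∈ S
      b∈S         : b ∈ S
      c∈S         : c ∈ S
      a≢b         : a ≢ b
      a≢c         : a ≢ c
      b≢c         : b ≢ c
      avoid       : ∀ x {y z} → y ∈ S → z ∈ S → y ≢ x → z ≢ x → Joined (λ w → w ∈ S × w ≢ x) y z

    other : ∀ y z → ∃ λ x → y ≢ x × z ≢ x
    other y z with y ≟ a | z ≟ a | y ≟ b | z ≟ b
    ... | no y≢a   | no z≢a   | _        | _        = a , y≢a , z≢a
    ... | yes refl | _        | _        | no z≢b   = b , a≢b , z≢b
    ... | yes refl | _        | _        | yes refl = c , a≢c , b≢c
    ... | no _     | yes refl | no y≢b   | _        = b , y≢b , a≢b
    ... | no _     | yes refl | yes refl | _        = c , b≢c , a≢c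

    join : ∀ {y z} → y ∈ S → z ∈ S → Joined (_∈ S) y z
    join {y} {z} y∈ z∈ with other y z
    ... | x , y≢x , z≢x = Joined-mono proj₁ (avoid x y∈ z∈ y≢x z≢x)

  -- Whichever vertex is deleted, one of the two shared vertices survives and serves as a hub that
  -- every remaining vertex reaches within its own set.
  biconnected-∪ : ∀ {S T s t} → Biconnected S → Biconnected T →
                  s ≢ t → s ∈ S → s ∈ T → t ∈ S → t ∈ T → Biconnected (S ∪ T)
  biconnected-∪ {S} {T} {s} {t} bS bT s≢t s∈S s∈T t∈S t∈T = record
    { a∈S = left S.a∈S ; b∈S = left S.b∈S ; c∈S = left S.c∈S
    ; a≢b = S.a≢b ; a≢c = S.a≢c ; b≢c = S.b≢c
    ; avoid = avoid }
    where
    module S = Biconnected bS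
    module T = Biconnected bT
    left : ∀ {x} → x ∈ S → x ∈ S ∪ T
    left = x∈p∪q⁺ ∘ inj₁
    right : ∀ {x} → x ∈ T → x ∈ S ∪ T
    right = x∈p∪q⁺ {p = S} ∘ inj₂
    shared : ∀ x → ∃ λ h → h ∈ S × h ∈ T × h ≢ x
    shared x with s ≟ x
    ... | no s≢x   = s , s∈S , s∈T , s≢x
    ... | yes refl = t , t∈S , t∈T , s≢t ∘ sym
    avoid : ∀ x {y z} → y ∈ S ∪ T → z ∈ S ∪ T → y ≢ x → z ≢ x →
            Joined (λ w → w ∈ S ∪ T × w ≢ x) y z
    avoid x y∈ z∈ y≢x z≢x with shared x
    ... | h , h∈S , h∈T , h≢x = to-hub y∈ y≢x ◅◅ Joined-sym (to-hub z∈ z≢x)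
      where
      to-hub : ∀ {y} → y ∈ S ∪ T → y ≢ x → Joined (λ w → w ∈ S ∪ T × w ≢ x) y h
      to-hub y∈ y≢x with x∈p∪q⁻ S T y∈
      ... | inj₁ y∈S = Joined-mono (λ (w∈ , w≢) → left w∈ , w≢) (S.avoid x y∈S h∈S y≢x h≢x)
      ... | inj₂ y∈T = Joined-mono (λ (w∈ , w≢) → right w∈ , w≢) (T.avoid x y∈T h∈T y≢x h≢x)

  -- A general `π` covers both `G [ S ]` and `G [ S ]` with a vertex removed. Injectivity makes the
  -- walk end at `b` itself and not at another point over `y`.
  joined-walk : ∀ {W : Set} (H : Graph W) (π : W → Fin n) {P : Pred (Fin n) 0ℓ} →
                (∀ {a b} → π a ≡ π b → a ≡ b) → (∀ {a b} → π a ~ π b → Adj H a b) →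
                (∀ {x} → P x → ∃ λ w → π w ≡ x) →
                ∀ {x y} → Joined P x y → ∀ {a b} → π a ≡ x → π b ≡ y → ∃ (Walk H a b)
  joined-walk H π inj adj lift ε refl eq with inj eq
  ... | refl = 0 , []
  joined-walk H π inj adj lift ((e , _ , py) ◅ s) refl eq with lift py
  ... | w , refl with joined-walk H π inj adj lift s refl eq
  ... | ℓ , p = suc ℓ , adj e ∷ p

  private
    ∈-≡ : ∀ {S : Subset n} {a b : Σ (Fin n) (_∈ S)} → proj₁ a ≡ proj₁ b → a ≡ b
    ∈-≡ {a = x , p} {_ , q} refl = cong (x ,_) ([]=-irrelevant p q)

  twoConnected : ∀ {S} → Biconnected S → TwoConnected (G [ S ])
  twoConnected {S} bS = mk↣ {to = three} three-injective , connected , connected-minus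
    where
    open Biconnected bS
    three : Fin 3 → Σ (Fin n) (_∈ S)
    three zero             = a , a∈S
    three (suc zero)       = b , b∈S
    three (suc (suc zero)) = c , c∈S
    three-injective : ∀ {i j} → three i ≡ three j → i ≡ j
    three-injective {zero}           {zero}           _  = refl
    three-injective {zero}           {suc zero}       eq = contradiction (cong proj₁ eq) a≢b
    three-injective {zero}           {suc (suc zero)} eq = contradiction (cong proj₁ eq) a≢c
    three-injective {suc zero}       {zero}           eq = contradiction (cong proj₁ (sym eq)) a≢b
    three-injective {suc zero}       {suc zero}       _  = refl
    three-injective {suc zero}       {suc (suc zero)} eq = contradiction (cong proj₁ eq) b≢c
    three-injective {suc (suc zero)} {zero}           eq = contradiction (cong proj₁ (sym eq)) a≢c
    three-injective {suc (suc zero)} {suc zero}       eq = contradiction (cong proj₁ (sym eq)) b≢c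
    three-injective {suc (suc zero)} {suc (suc zero)} _  = refl
    connected : Connected (G [ S ])
    connected (y , y∈) (z , z∈) =
      joined-walk (G [ S ]) proj₁ ∈-≡ id (λ p → (_ , p) , refl) (join y∈ z∈) refl refl
    connected-minus : ∀ x → Connected ((G [ S ]) - x)
    connected-minus (x , x∈) ((y , y∈) , y≢) ((z , z∈) , z≢) =
      joined-walk ((G [ S ]) - (x , x∈)) (proj₁ ∘ proj₁) minus-≡ id
        (λ (p , w≢) → ((_ , p) , w≢ ∘ cong proj₁) , refl)
        (avoid x y∈ z∈ (y≢ ∘ ∈-≡) (z≢ ∘ ∈-≡)) refl refl
      where
      minus-≡ : ∀ {a b : Σ (Σ (Fin n) (_∈ S)) (_≢ (x , x∈))} → proj₁ (proj₁ a) ≡ proj₁ (proj₁ b) → a ≡ b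
      minus-≡ {a , _} {b , _} eq with ∈-≡ {a = a} {b} eq
      ... | refl = refl

  -- Cycles given by sequences of vertices.

  -- The cycle has `suc m` vertices, so an even `m` means an odd cycle. Values of `f` beyond `m` are
  -- arbitrary, which allows vertices to be prepended without arithmetic on `Fin`.
  record Cycle (f : ℕ → Fin n) (m : ℕ) : Set where
    field
      2≤m       : 2 ≤ m
      injective : ∀ {i j} → i < j → j ≤ m → f i ≢ f j
      step      : ∀ {i} → i < m → f i ~ f (suc i)
      close     : f m ~ f 0

    injective′ : ∀ {i j} → i ≤ m → j ≤ m → f i ≡ f j → i ≡ j
    injective′ {i} {j} i≤m j≤m eq with ℕ.<-cmp i j
    ... | tri< i<j _ _ = contradiction eq (injective i<j j≤m)
    ... | tri≈ _ i≡j _ = i≡j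
    ... | tri> _ _ j<i = contradiction (sym eq) (injective j<i i≤m)

    OnCycle : Pred (Fin n) 0ℓ
    OnCycle x = ∃ λ i → i < suc m × f i ≡ x

    onCycle? : Decidable OnCycle
    onCycle? x = ℕ.anyUpTo? (λ i → f i ≟ x) (suc m)

    vertices : Subset n
    vertices = subset onCycle?

    ∈-vertices : ∀ {i} → i ≤ m → f i ∈ vertices
    ∈-vertices i≤m = ∈-subset⁺ onCycle? (_ , s≤s i≤m , refl)

    segment : ∀ {P : Pred (Fin n) 0ℓ} {i} j → i ≤ j → j ≤ m →
              (∀ {l} → i ≤ l → l ≤ j → P (f l)) → Joined P (f i) (f j)
    segment {i = i} j i≤j j≤m p with ℕ.m≤n⇒m<n∨m≡n i≤j
    ... | inj₂ refl = ε
    segment (suc j) _ j<m p | inj₁ (s≤s i≤j) =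
      segment j i≤j (ℕ.<⇒≤ j<m) (λ i≤l l≤j → p i≤l (ℕ.m≤n⇒m≤1+n l≤j)) ◅◅
      (step j<m , p i≤j (ℕ.n≤1+n j) , p (ℕ.m≤n⇒m≤1+n i≤j) ℕ.≤-refl) ◅ ε

    -- Once `x` is deleted, `f i` runs down to `f 0` if `x` is not among `f 0`, ..., `f i`, and up
    -- to `f m` otherwise. The closing edge links the two ends.
    biconnected : Biconnected vertices
    biconnected = record
      { a∈S = ∈-vertices {0} z≤n ; b∈S = ∈-vertices {1} 1≤m ; c∈S = ∈-vertices {2} 2≤m
      ; a≢b = injective z<s 1≤m ; a≢c = injective z<s 2≤m ; b≢c = injective (s≤s z<s) 2≤m
      ; avoid = avoid }
      where
      1≤m : 1 ≤ m
      1≤m = ℕ.<⇒≤ 2≤m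
      avoid : ∀ x {y z} → y ∈ vertices → z ∈ vertices → y ≢ x → z ≢ x →
              Joined (λ w → w ∈ vertices × w ≢ x) y z
      avoid x y∈ z∈ y≢x z≢x = meet (to-end y∈ y≢x) (to-end z∈ z≢x)
        where
        Q : Pred (Fin n) 0ℓ
        Q w = w ∈ vertices × w ≢ x
        -- An empty path does not certify `Q` at its end point, so `Q` is recorded separately for
        -- use with the closing edge.
        End : Pred (Fin n) 0ℓ
        End y = (Joined Q y (f 0) × Q (f 0)) ⊎ (Joined Q y (f m) × Q (f m))
        to-end : ∀ {y} → y ∈ vertices → y ≢ x → End y
        to-end y∈ y≢x with ∈-subset⁻ onCycle? y∈
        ... | i , s≤s i≤m , refl with ℕ.anyUpTo? (λ l → f l ≟ x) (suc i)
        ...   | no x∉ = inj₁ (Joined-sym (segment i z≤n i≤m (λ _ → q)) , q z≤n)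
          where
          q : ∀ {l} → l ≤ i → Q (f l)
          q l≤i = ∈-vertices (ℕ.≤-trans l≤i i≤m) , λ eq → x∉ (_ , s≤s l≤i , eq)
        ...   | yes (t , s≤s t≤i , refl) = inj₂ (segment m i≤m ℕ.≤-refl q , q i≤m ℕ.≤-refl)
          where
          q : ∀ {l} → i ≤ l → l ≤ m → Q (f l)
          q i≤l l≤m = ∈-vertices l≤m ,
            injective (ℕ.<-≤-trans (ℕ.≤∧≢⇒< t≤i (y≢x ∘ cong f ∘ sym)) i≤l) l≤m ∘ sym
        meet : ∀ {y z} → End y → End z → Joined Q y z
        meet (inj₁ (p , _)) (inj₁ (q , _)) = p ◅◅ Joined-sym q
        meet (inj₂ (p , _)) (inj₂ (q , _)) = p ◅◅ Joined-sym q
        meet (inj₁ (p , q₀)) (inj₂ (q , qₘ)) = p ◅◅ (~-sym close , q₀ , qₘ) ◅ Joined-sym q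
        meet (inj₂ (p , qₘ)) (inj₁ (q , q₀)) = p ◅◅ (close , qₘ , q₀) ◅ Joined-sym q

    -- Injections in both directions compare the two vertex sets. This lets the parity of `m` refute
    -- an isomorphism with an odd cycle.
    length-cycle : ∀ {k} → (G [ vertices ]) ≅ cycleGraph k → suc m ≡ 3 + k
    length-cycle {k} (iso , _) =
      ℕ.≤-antisym (Fin.injective⇒≤ {f = toCycle} toCycle-injective)
                  (Fin.injective⇒≤ {f = fromCycle} fromCycle-injective)
      where
      open Inverse iso
      toCycle : Fin (suc m) → Fin (3 + k)
      toCycle i = to (f (toℕ i) , ∈-vertices (toℕ≤pred[n] i))
      toCycle-injective : ∀ {i j} → toCycle i ≡ toCycle j → i ≡ j
      toCycle-injective {i} {j} eq = toℕ-injective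
        (injective′ (toℕ≤pred[n] i) (toℕ≤pred[n] j) (cong proj₁ (Injection.injective (↔⇒↣ iso) eq)))
      position : ∀ t → OnCycle (proj₁ (from t))
      position t = ∈-subset⁻ onCycle? (proj₂ (from t))
      fromCycle : Fin (3 + k) → Fin (suc m)
      fromCycle t = fromℕ< (proj₁ (proj₂ (position t)))
      fromCycle-injective : ∀ {s t} → fromCycle s ≡ fromCycle t → s ≡ t
      fromCycle-injective {s} {t} eq = Injection.injective (↔⇒↣ (↔-sym iso)) (∈-≡ same-vertex)
        where
        same-vertex : proj₁ (from s) ≡ proj₁ (from t)
        same-vertex = trans (sym (proj₂ (proj₂ (position s))))
          (trans (cong f (trans (sym (toℕ-fromℕ< _)) (trans (cong toℕ eq) (toℕ-fromℕ< _))))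
                 (proj₂ (proj₂ (position t))))

  3-neighbours⇒¬cycle : ∀ {S x a b c} → x ∈ S → a ∈ S → b ∈ S → c ∈ S →
                        a ≢ b → a ≢ c → b ≢ c → x ~ a → x ~ b → x ~ c → ¬ IsCycle (G [ S ])
  3-neighbours⇒¬cycle x∈ a∈ b∈ c∈ a≢b a≢c b≢c xa xb xc (k , iso , adj)
    with cycle-degree≤2 k (image {b = _ , a∈} xa) (image {b = _ , b∈} xb) (image {b = _ , c∈} xc)
    where
    image : ∀ {b} → _ ~ proj₁ b → Adj (cycleGraph k) (Inverse.to iso (_ , x∈)) (Inverse.to iso b)
    image {b} = Equivalence.to (adj (_ , x∈) b)
  ... | inj₁ eq        = a≢b (cong proj₁ (Injection.injective (↔⇒↣ iso) eq))
  ... | inj₂ (inj₁ eq) = a≢c (cong proj₁ (Injection.injective (↔⇒↣ iso) eq))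
  ... | inj₂ (inj₂ eq) = b≢c (cong proj₁ (Injection.injective (↔⇒↣ iso) eq))

  -- Closed neighbourhoods, and cycles that exhaust the graph.

  walk-closed : (P : Pred (Fin n) 0ℓ) → (∀ {x y} → P x → x ~ y → P y) →
                ∀ {x y ℓ} → Walk G x y ℓ → P x → P y
  walk-closed P closed []      px = px
  walk-closed P closed (e ∷ w) px = walk-closed P closed w (closed px e)

  neighbours : Fin n → List (Fin n)
  neighbours x = select (x ~?_)

  -- The closed neighbourhood of `x` has `suc (degree G x)` members, so `zs` already fills it and a
  -- further neighbour would not fit. In this way degree bounds seal off a cycle and, later, a
  -- clique.
  full-neighbours : ∀ {x y} {zs : List (Fin n)} → Unique zs → (∀ {z} → z ∈ˡ zs → z ≡ x ⊎ x ~ z) →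
                    degree G x < length zs → x ~ y → y ∈ˡ zs
  full-neighbours {x} {y} {zs} unique near deg< xy with Any.any? (y ≟_) zs
  ... | yes y∈ = y∈
  ... | no y∉  = contradiction (ℕ.<-≤-trans (s≤s deg<) (length-⊆ (fresh ∷ unique) near′)) (ℕ.<-irrefl refl)
    where
    fresh : All (y ≢_) zs
    fresh = All.tabulate λ z∈ eq → y∉ (subst (_∈ˡ zs) (sym eq) z∈)
    near′ : ∀ {z} → z ∈ˡ y ∷ zs → z ∈ˡ x ∷ neighbours x
    near′ (here refl) = there (∈-select⁺ (x ~?_) xy)
    near′ (there z∈) with near z∈
    ... | inj₁ refl = here refl
    ... | inj₂ xz   = there (∈-select⁺ (x ~?_) xz)

  -- Degree at most 2 leaves a cycle vertex no neighbours besides its successor and predecessor.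
  -- Hence the cycle has no chord, is closed under adjacency, and exhausts the connected graph.
  cycle⇒IsCycle : ∀ {f m} → Connected G → Cycle f m → (∀ {i} → i ≤ m → degree G (f i) ≤ 2) → IsCycle G
  cycle⇒IsCycle {f} {suc zero} conn cyc deg≤2 = contradiction (Cycle.2≤m cyc) λ { (s≤s ()) }
  cycle⇒IsCycle {f} {suc (suc k)} conn cyc deg≤2 =
    k , mk↔ₛ′ index vertex index-vertex vertex-index , λ x y → mk⇔ (to-adj x y) (from-adj x y)
    where
    open Cycle cyc
    vertex : Fin (3 + k) → Fin n
    vertex i = f (toℕ i)
    next-adj : ∀ {i j} → Next k i j → vertex i ~ vertex j
    next-adj {i} {j} (inj₁ p)       =
      subst (λ l → vertex i ~ f l) (sym p) (step (ℕ.≤-trans (ℕ.≤-reflexive (sym p)) (toℕ≤pred[n] j)))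
    next-adj {i} {j} (inj₂ (p , q)) = subst₂ (λ l l′ → f l ~ f l′) (sym p) (sym q) close
    vertex-injective : ∀ {i j} → vertex i ≡ vertex j → i ≡ j
    vertex-injective {i} {j} = toℕ-injective ∘ injective′ (toℕ≤pred[n] i) (toℕ≤pred[n] j)
    neighbour : ∀ i {y} → vertex i ~ y → ∃ λ j → (Next k i j ⊎ Next k j i) × vertex j ≡ y
    neighbour i {y} iy with ∃-next k i | ∃-prev k i
    ... | s , is | p , pi
      with full-neighbours ((irrefl (next-adj is) ∷ irrefl (~-sym (next-adj pi)) ∷ []) ∷ (vs≢vp ∷ []) ∷ [] ∷ [])
                           near (s≤s (deg≤2 (toℕ≤pred[n] i))) iy
      where
      irrefl : ∀ {x y} → x ~ y → x ≢ y
      irrefl e eq = ~-irrefl eq e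
      vs≢vp : vertex s ≢ vertex p
      vs≢vp eq with vertex-injective eq
      ... | refl = next-asym k is pi
      near : ∀ {z} → z ∈ˡ vertex i ∷ vertex s ∷ vertex p ∷ [] → z ≡ vertex i ⊎ vertex i ~ z
      near (here refl)                 = inj₁ refl
      near (there (here refl))         = inj₂ (next-adj is)
      near (there (there (here refl))) = inj₂ (~-sym (next-adj pi))
    ... | here refl                 = contradiction iy (~-irrefl refl)
    ... | there (here refl)         = s , inj₁ is , refl
    ... | there (there (here refl)) = p , inj₂ pi , refl
    reached : ∀ x → ∃ λ i → vertex i ≡ x
    reached x = walk-closed (λ x → ∃ λ i → vertex i ≡ x)
      (λ { (i , refl) e → proj₁ (neighbour i e) , proj₂ (proj₂ (neighbour i e)) })
      (proj₂ (conn (f 0) x)) (zero , refl)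
    index : Fin n → Fin (3 + k)
    index = proj₁ ∘ reached
    vertex-index : ∀ x → vertex (index x) ≡ x
    vertex-index = proj₂ ∘ reached
    index-vertex : ∀ i → index (vertex i) ≡ i
    index-vertex i = vertex-injective (vertex-index (vertex i))
    to-adj : ∀ x y → x ~ y → Adj (cycleGraph k) (index x) (index y)
    to-adj x y xy with neighbour (index x) (subst (_~ y) (sym (vertex-index x)) xy)
    ... | j , next , eq with vertex-injective {j} {index y} (trans eq (sym (vertex-index y)))
    ... | refl with next
    ...   | inj₁ p = next⇒cycle-adj k p
    ...   | inj₂ p = Graph.~-sym (cycleGraph k) {index y} {index x} (next⇒cycle-adj k p)
    from-adj : ∀ x y → Adj (cycleGraph k) (index x) (index y) → x ~ y
    from-adj x y e = subst₂ _~_ (vertex-index x) (vertex-index y)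
      ([ next-adj , ~-sym ∘ next-adj ]′ (cycle-adj⇒next k e))

  -- Distances, levels and parents.

  walk-snoc : ∀ {x y z ℓ} → Walk G x y ℓ → y ~ z → Walk G x z (suc ℓ)
  walk-snoc []      e = e ∷ []
  walk-snoc (d ∷ w) e = d ∷ walk-snoc w e

  walk-unsnoc : ∀ {x z ℓ} → Walk G x z (suc ℓ) → ∃ λ y → Walk G x y ℓ × y ~ z
  walk-unsnoc {ℓ = zero}  (e ∷ [])        = _ , [] , e
  walk-unsnoc {ℓ = suc ℓ} (d ∷ w) with walk-unsnoc w
  ... | y , w′ , e = y , d ∷ w′ , e

  distance-unique : ∀ {x y d e} → Distance G x y d → Distance G x y e → d ≡ e
  distance-unique {d = d} {e} (w , min) (w′ , min′) with ℕ.<-cmp d e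
  ... | tri< d<e _ _ = contradiction w (min′ d<e)
  ... | tri≈ _ d≡e _ = d≡e
  ... | tri> _ _ e<d = contradiction w′ (min e<d)

  abstract
    ∃-distance : Connected G → ∀ x y → ∃ (Distance G x y)
    ∃-distance conn x y with search (suc (proj₁ (conn x y)))
      where
      search : ∀ k → ∃ (Distance G x y) ⊎ (∀ {ℓ} → ℓ < k → ¬ Walk G x y ℓ)
      search zero = inj₂ λ ()
      search (suc k) with search k
      ... | inj₁ found = inj₁ found
      ... | inj₂ none with walk? G x y k
      ...   | yes w = inj₁ (k , w , none)
      ...   | no ¬w = inj₂ λ ℓ<1+k → [ none , (λ { refl → ¬w }) ]′ (ℕ.m<1+n⇒m<n∨m≡n ℓ<1+k)
    ... | inj₁ found = found
    ... | inj₂ none  = contradiction (proj₂ (conn x y)) (none ℕ.≤-refl)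

  module _ (connected : Connected G) (v : Fin n) where

    lev : Fin n → ℕ
    lev x = proj₁ (∃-distance connected v x)

    lev-distance : ∀ x → Distance G v x (lev x)
    lev-distance x = proj₂ (∃-distance connected v x)

    lev-minimal : ∀ {x ℓ} → Walk G v x ℓ → lev x ≤ ℓ
    lev-minimal w = ℕ.≮⇒≥ λ ℓ<lev → proj₂ (lev-distance _) ℓ<lev w

    lev-step : ∀ {x y} → x ~ y → lev y ≤ suc (lev x)
    lev-step {x} e = lev-minimal (walk-snoc (proj₁ (lev-distance x)) e)

    lev≡0⇒root : ∀ {x} → lev x ≡ 0 → x ≡ v
    lev≡0⇒root {x} eq with lev x | proj₁ (lev-distance x)
    lev≡0⇒root refl | zero | [] = refl

    Upward Sideways Downward : Fin n → Fin n → Set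
    Upward   x y = x ~ y × suc (lev y) ≡ lev x
    Sideways x y = x ~ y × lev y ≡ lev x
    Downward x y = x ~ y × lev y ≡ suc (lev x)

    upward? : ∀ x → Decidable (Upward x)
    upward? x y = (x ~? y) ×-dec (suc (lev y) ℕ.≟ lev x)
    sideways? : ∀ x → Decidable (Sideways x)
    sideways? x y = (x ~? y) ×-dec (lev y ℕ.≟ lev x)
    downward? : ∀ x → Decidable (Downward x)
    downward? x y = (x ~? y) ×-dec (lev y ℕ.≟ suc (lev x))

    direction : ∀ {x y} → x ~ y → Upward x y ⊎ Downward x y ⊎ Sideways x y
    direction {x} {y} e with ℕ.<-cmp (lev x) (lev y)
    ... | tri< x<y _ _ = inj₂ (inj₁ (e , ℕ.≤-antisym (lev-step e) x<y))
    ... | tri≈ _ x≡y _ = inj₂ (inj₂ (e , sym x≡y))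
    ... | tri> _ _ y<x = inj₁ (e , ℕ.≤-antisym y<x (lev-step (~-sym e)))

    ∃-upward : ∀ {x d} → lev x ≡ suc d → ∃ (Upward x)
    ∃-upward {x} {d} eq with walk-unsnoc (subst (Walk G v x) eq (proj₁ (lev-distance x)))
    ... | p , w , e = p , ~-sym e ,
      ℕ.≤-antisym (ℕ.≤-trans (s≤s (lev-minimal w)) (ℕ.≤-reflexive (sym eq))) (lev-step e)

    abstract
      -- A fixed choice among the upward neighbours. Cycles built from this choice are what later
      -- proves it to be the only one in the ball.
      parent : Fin n → Fin n
      parent x with any? (upward? x)
      ... | yes (p , _) = p
      -- Only the root falls under this default.
      ... | no _        = x

      parent-upward : ∀ {x d} → lev x ≡ suc d → Upward x (parent x)
      parent-upward {x} eq with any? (upward? x)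
      ... | yes (_ , up) = up
      ... | no none      = contradiction (∃-upward eq) none

    lev-parent : ∀ {x d} → lev x ≡ suc d → lev (parent x) ≡ d
    lev-parent eq = ℕ.suc-injective (trans (proj₂ (parent-upward eq)) eq)

    same-level-≢ : ∀ {x y} → x ≢ y → lev y ≡ lev x → ∃ λ d → lev x ≡ suc d
    same-level-≢ {x} x≢y eq with lev x in lev-x
    ... | suc d = d , refl
    ... | zero  = contradiction (trans (lev≡0⇒root lev-x) (sym (lev≡0⇒root eq))) x≢y

    sideways-lev : ∀ {x y} → Sideways x y → ∃ λ d → lev x ≡ suc d
    sideways-lev (e , eq) = same-level-≢ (λ x≡y → ~-irrefl x≡y e) eq

    -- Paths through the lowest common ancestor.

    climb : ℕ → Fin n → Fin n
    climb zero    x = x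
    climb (suc i) x = climb i (parent x)

    -- The path from a up to the lowest common ancestor at f h and down to b.
    record Arc (a b : Fin n) : Set where
      field
        f         : ℕ → Fin n
        h         : ℕ
        start     : f 0 ≡ a
        end       : f (h * 2) ≡ b
        injective : ∀ {i j} → i < j → j ≤ h * 2 → f i ≢ f j
        step      : ∀ {i} → i < h * 2 → f i ~ f (suc i)
        below     : ∀ {i} → i ≤ h * 2 → lev (f i) ≤ lev a
        up        : ∀ {i} → i ≤ h → f i ≡ climb i a
        meet      : climb h a ≡ climb h b

      up∈ : ∀ {i} → i ≤ h → i ≤ h * 2
      up∈ i≤h = ℕ.≤-trans i≤h (ℕ.m≤m*n h 2)

      0<h : a ≢ b → 0 < h
      0<h a≢b = ℕ.≤∧≢⇒< z≤n λ eq → a≢b (subst (λ i → climb i a ≡ climb i b) (sym eq) meet)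

      1<h : a ≢ b → parent a ≢ parent b → 1 < h
      1<h a≢b pa≢pb = ℕ.≤∧≢⇒< (0<h a≢b) λ eq → pa≢pb (subst (λ i → climb i a ≡ climb i b) (sym eq) meet)

    private
      -- The sequence `a`, `f 0`, ..., `f m`, `b`, by which an arc is extended one level down at
      -- both ends.
      surround : Fin n → (ℕ → Fin n) → ℕ → Fin n → ℕ → Fin n
      surround a f m b zero = a
      surround a f m b (suc i) with i ℕ.≤? m
      ... | yes _ = f i
      ... | no _  = b

    module _ (a : Fin n) (f : ℕ → Fin n) (m : ℕ) (b : Fin n) where
      inside : ∀ {i} → i ≤ m → surround a f m b (suc i) ≡ f i
      inside {i} i≤m with i ℕ.≤? m
      ... | yes _   = refl
      ... | no i≰m  = contradiction i≤m i≰m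

      outside : surround a f m b (2 + m) ≡ b
      outside with suc m ℕ.≤? m
      ... | yes 1+m≤m = contradiction 1+m≤m ℕ.1+n≰n
      ... | no _      = refl

    -- Induction on the common level: if `a` and `b` differ, the arc between their parents is
    -- extended by `a` and `b`. Its vertices lie on smaller levels than these, so nothing repeats.
    arc : ∀ d {a b} → lev a ≡ d → lev b ≡ d → Arc a b
    arc d {a} {b} lev-a lev-b with a ≟ b
    ... | yes refl = record
      { f = λ _ → a ; h = 0 ; start = refl ; end = refl
      ; injective = λ { {j = zero} () _ ; {j = suc _} _ () }
      ; step = λ () ; below = λ _ → ℕ.≤-refl ; up = λ { z≤n → refl } ; meet = refl }
    arc zero lev-a lev-b | no a≢b = contradiction (trans (lev≡0⇒root lev-a) (sym (lev≡0⇒root lev-b))) a≢b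
    arc (suc d) {a} {b} lev-a lev-b | no a≢b = record
      { f = F ; h = suc A.h ; start = refl ; end = out
      ; injective = F-injective ; step = F-step ; below = F-below ; up = F-up ; meet = A.meet }
      where
      lev-pa : lev (parent a) ≡ d
      lev-pa = lev-parent lev-a
      module A = Arc (arc d {parent a} {parent b} lev-pa (lev-parent lev-b))
      m = A.h * 2
      F = surround a A.f m b
      in′ : ∀ {i} → i ≤ m → F (suc i) ≡ A.f i
      in′ = inside a A.f m b
      out : F (2 + m) ≡ b
      out = outside a A.f m b
      inner : ∀ {i} → i ≤ m → lev (F (suc i)) ≤ d
      inner i≤m = ℕ.≤-trans (ℕ.≤-reflexive (cong lev (in′ i≤m))) (ℕ.≤-trans (A.below i≤m) (ℕ.≤-reflexive lev-pa))
      inner-≢ : ∀ {i x} → i ≤ m → lev x ≡ suc d → F (suc i) ≢ x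
      inner-≢ i≤m lev-x refl = ℕ.1+n≰n (subst (_≤ d) lev-x (inner i≤m))
      F-injective : ∀ {i j} → i < j → j ≤ 2 + m → F i ≢ F j
      F-injective {_} {suc j} i<j (s≤s j≤1+m) eq with ℕ.m≤n⇒m<n∨m≡n j≤1+m
      F-injective {zero}  _         _ eq | inj₁ (s≤s j≤m) = inner-≢ j≤m lev-a (sym eq)
      F-injective {zero}  _         _ eq | inj₂ refl      = a≢b (trans eq out)
      F-injective {suc i} (s≤s i<j) _ eq | inj₁ (s≤s j≤m) =
        A.injective i<j j≤m (trans (sym (in′ (ℕ.≤-trans (ℕ.<⇒≤ i<j) j≤m))) (trans eq (in′ j≤m)))
      F-injective {suc i} (s≤s (s≤s i≤m)) _ eq | inj₂ refl = inner-≢ i≤m lev-b (trans eq out)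
      F-step : ∀ {i} → i < 2 + m → F i ~ F (suc i)
      F-step {zero} _ =
        subst (a ~_) (sym (trans (in′ z≤n) A.start)) (proj₁ (parent-upward lev-a))
      F-step {suc i} (s≤s (s≤s i≤m)) with ℕ.m≤n⇒m<n∨m≡n i≤m
      ... | inj₁ i<m  = subst₂ _~_ (sym (in′ i≤m)) (sym (in′ i<m)) (A.step i<m)
      ... | inj₂ refl = subst₂ _~_ (sym (trans (in′ i≤m) A.end)) (sym out)
                          (~-sym (proj₁ (parent-upward lev-b)))
      F-below : ∀ {i} → i ≤ 2 + m → lev (F i) ≤ lev a
      F-below {zero} _ = ℕ.≤-refl
      F-below {suc i} (s≤s i≤1+m) with ℕ.m≤n⇒m<n∨m≡n i≤1+m
      ... | inj₁ (s≤s i≤m) =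
        ℕ.≤-trans (inner i≤m) (ℕ.≤-trans (ℕ.n≤1+n d) (ℕ.≤-reflexive (sym lev-a)))
      ... | inj₂ refl = ℕ.≤-reflexive (trans (cong lev out) (trans lev-b (sym lev-a)))
      F-up : ∀ {i} → i ≤ suc A.h → F i ≡ climb i a
      F-up {zero}  _         = refl
      F-up {suc i} (s≤s i≤h) = trans (in′ (A.up∈ i≤h)) (A.up i≤h)

    -- Odd cycles closed by edges inside a level.

    same children : Fin n → List (Fin n)
    same x     = select (sideways? x)
    children x = select (downward? x)

    ∈-same⁻ : ∀ {x y} → y ∈ˡ same x → Sideways x y
    ∈-same⁻ {x} = ∈-select⁻ (sideways? x)

    ∈-children⁻ : ∀ {x y} → y ∈ˡ children x → Downward x y
    ∈-children⁻ {x} = ∈-select⁻ (downward? x)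

    levels-≢ : ∀ {x y} → lev x < lev y → x ≢ y
    levels-≢ x<y refl = ℕ.<-irrefl refl x<y

    below-parent : ∀ {x d} → lev x ≡ suc d → lev (parent x) < lev x
    below-parent eq = ℕ.≤-reflexive (proj₂ (parent-upward eq))

    arc-cycle : ∀ {a b} (A : Arc a b) → a ~ b → Cycle (Arc.f A) (Arc.h A * 2)
    arc-cycle A a~b = record
      { 2≤m = ℕ.*-monoˡ-≤ 2 (A.0<h λ a≡b → ~-irrefl a≡b a~b)
      ; injective = A.injective ; step = A.step
      ; close = subst₂ _~_ (sym A.end) (sym A.start) (~-sym a~b) }
      where module A = Arc A

    -- The listed members are those along which two such cycles are glued: the edge from `a` to its
    -- parent and, when `a` and `b` have different parents, the next edge upwards.
    ∃-biconnected : ∀ {a b} → Sideways a b → ∃ λ S → Biconnected S × (∀ {x} → x ∈ S → lev x ≤ lev a) ×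
                    a ∈ S × b ∈ S × parent a ∈ S × (parent a ≢ parent b → parent (parent a) ∈ S)
    ∃-biconnected {a} {b} (a~b , eq) =
      vertices , biconnected , low ,
      subst (_∈ vertices) A.start (∈-vertices z≤n) ,
      subst (_∈ vertices) A.end (∈-vertices ℕ.≤-refl) ,
      up∈vertices (A.0<h a≢b) , λ pa≢pb → up∈vertices (A.1<h a≢b pa≢pb)
      where
      a≢b : a ≢ b
      a≢b a≡b = ~-irrefl a≡b a~b
      module A = Arc (arc (lev a) {a} {b} refl eq)
      open Cycle (arc-cycle (arc (lev a) {a} {b} refl eq) a~b)
      up∈vertices : ∀ {i} → i ≤ A.h → climb i a ∈ vertices
      up∈vertices i≤h = subst (_∈ vertices) (A.up i≤h) (∈-vertices (A.up∈ i≤h))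
      low : ∀ {x} → x ∈ vertices → lev x ≤ lev a
      low x∈ with ∈-subset⁻ onCycle? x∈
      ... | i , s≤s i≤m , refl = A.below i≤m

    sideways-IsCycle : ∀ {a b} → Sideways a b → (∀ {x} → lev x ≤ lev a → degree G x ≤ 2) → IsCycle G
    sideways-IsCycle {a} {b} (a~b , eq) deg≤2 =
      cycle⇒IsCycle connected (arc-cycle path a~b) (deg≤2 ∘ Arc.below path)
      where
      path : Arc a b
      path = arc (lev a) refl eq

    -- Consequences of the absence of degree-choosable components.

    module _ (r : ℕ) (noDCC : ∀ S → IsDCC G S → ¬ (∀ x → x ∈ S → lev x ≤ r)) where

      parent-unique : ∀ {u p} → lev u ≤ r → Upward u p → p ≡ parent u
      parent-unique {u} {p} u≤r (u~p , lev-u) with p ≟ parent u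
      ... | yes eq = eq
      ... | no p≢q = contradiction (λ _ → low) (noDCC vertices (twoConnected biconnected , ¬clique , ¬oddCycle))
        where
        q = parent u
        lev-q : lev q ≡ lev p
        lev-q = lev-parent (sym lev-u)
        module A = Arc (arc (lev p) {p} {q} refl lev-q)
        m = A.h * 2
        f : ℕ → Fin n
        f zero    = u
        f (suc i) = A.f i
        above : ∀ {i} → i ≤ m → lev (A.f i) < lev u
        above i≤m = ℕ.≤-trans (s≤s (A.below i≤m)) (ℕ.≤-reflexive lev-u)
        cycle : Cycle f (suc m)
        cycle = record
          { 2≤m = s≤s (ℕ.≤-trans (A.0<h p≢q) (ℕ.m≤m*n A.h 2))
          ; injective = inj
          ; step = st
          ; close = subst (_~ u) (sym A.end) (~-sym (proj₁ (parent-upward (sym lev-u)))) }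
          where
          inj : ∀ {i j} → i < j → j ≤ suc m → f i ≢ f j
          inj {zero}  {suc j} _         (s≤s j≤m) = levels-≢ (above j≤m) ∘ sym
          inj {suc i} {suc j} (s≤s i<j) (s≤s j≤m) = A.injective i<j j≤m
          st : ∀ {i} → i < suc m → f i ~ f (suc i)
          st {zero}  _         = subst (u ~_) (sym A.start) u~p
          st {suc i} (s≤s i<m) = A.step i<m
        open Cycle cycle
        low : ∀ {x} → x ∈ vertices → lev x ≤ r
        low x∈ with ∈-subset⁻ onCycle? x∈
        ... | zero  , _                , refl = u≤r
        ... | suc i , s≤s (s≤s i≤m) , refl = ℕ.≤-trans (ℕ.<⇒≤ (above i≤m)) u≤r
        -- As `p` and `q` differ, the arc rises at least one level above `p`.
        top∈ : parent p ∈ vertices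
        top∈ = subst (_∈ vertices) (A.up (A.0<h p≢q)) (∈-vertices (s≤s (A.up∈ (A.0<h p≢q))))
        -- The neighbour of p on the cycle is two levels above u.
        ¬clique : ¬ IsClique (G [ vertices ])
        ¬clique clique with same-level-≢ p≢q lev-q
        ... | d , lev-p = ℕ.<⇒≱ top<p (s≤s⁻¹ (ℕ.≤-trans (ℕ.≤-reflexive lev-u) (lev-step top~u)))
          where
          top<p : lev (parent p) < lev p
          top<p = below-parent lev-p
          top<u : lev (parent p) < lev u
          top<u = ℕ.<-trans top<p (ℕ.≤-reflexive lev-u)
          top~u : parent p ~ u
          top~u = clique (_ , top∈) (_ , ∈-vertices {0} z≤n) (levels-≢ top<u ∘ cong proj₁)
        ¬oddCycle : ¬ IsOddCycle (G [ vertices ])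
        -- The arc has `suc (A.h * 2)` vertices and `u` is one more, which makes `suc A.h * 2`.
        ¬oddCycle (k , odd , iso) = odd (divides (suc A.h) (sym (length-cycle iso)))

      -- A 2-connected set in the ball is a clique or an odd cycle, and a vertex with three
      -- neighbours inside excludes the cycle. Apart from `parent-unique`, `noDCC` enters only here.
      3-neighbours⇒clique : ∀ {S x a b c} → Biconnected S → (∀ {y} → y ∈ S → lev y ≤ r) →
                            x ∈ S → a ∈ S → b ∈ S → c ∈ S → a ≢ b → a ≢ c → b ≢ c →
                            x ~ a → x ~ b → x ~ c → ∀ {y z} → y ∈ S → z ∈ S → y ≢ z → y ~ z
      3-neighbours⇒clique {S} bS low x∈ a∈ b∈ c∈ a≢b a≢c b≢c xa xb xc {y} {z} y∈ z∈ y≢z with y ~? z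
      ... | yes y~z = y~z
      ... | no y≁z  = contradiction (λ _ → low) (noDCC S
        ( twoConnected bS
        , (λ clique → y≁z (clique (_ , y∈) (_ , z∈) (y≢z ∘ cong proj₁)))
        , (λ (k , _ , iso) → 3-neighbours⇒¬cycle x∈ a∈ b∈ c∈ a≢b a≢c b≢c xa xb xc (k , iso))))

      -- The two cycles closed by these edges share the edge from u to its parent.
      sideways-clique : ∀ {u a b} → lev u ≤ r → Sideways u a → Sideways u b → a ≢ b →
                        a ~ b × a ~ parent u
      sideways-clique {u} {a} {b} u≤r ua ub a≢b
        with ∃-biconnected ua | ∃-biconnected ub | sideways-lev ua
      ... | S , bS , lowS , u∈S , a∈S , p∈S , _ | T , bT , lowT , u∈T , b∈T , p∈T , _ | d , lev-u =
        adj (left a∈S) (right b∈T) a≢b , adj (left a∈S) (left p∈S) (levels-≢ (p< ua) ∘ sym)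
        where
        left : ∀ {x} → x ∈ S → x ∈ S ∪ T
        left = x∈p∪q⁺ ∘ inj₁
        right : ∀ {x} → x ∈ T → x ∈ S ∪ T
        right = x∈p∪q⁺ {p = S} ∘ inj₂
        p< : ∀ {y} → Sideways u y → lev (parent u) < lev y
        p< (_ , eq) = ℕ.<-≤-trans (below-parent lev-u) (ℕ.≤-reflexive (sym eq))
        adj : ∀ {y z} → y ∈ S ∪ T → z ∈ S ∪ T → y ≢ z → y ~ z
        adj = 3-neighbours⇒clique
          (biconnected-∪ bS bT (levels-≢ (below-parent lev-u) ∘ sym) u∈S u∈T p∈S p∈T)
          (λ y∈ → ℕ.≤-trans ([ lowS , lowT ]′ (x∈p∪q⁻ S T y∈)) u≤r)
          (left u∈S) (left a∈S) (right b∈T) (left p∈S)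
          a≢b (levels-≢ (p< ua) ∘ sym) (levels-≢ (p< ub) ∘ sym)
          (proj₁ ua) (proj₁ ub) (proj₁ (parent-upward lev-u))

      -- Otherwise the cycle through the edge from u to w and the one through the edge from
      -- parent u to p′ share the edge from parent u to its own parent.
      sideways-siblings : ∀ {u w p′} → lev u ≤ r → Sideways (parent u) p′ → Sideways u w →
                          parent w ≡ parent u
      sideways-siblings {u} {w} {p′} u≤r pp′ uw with parent w ≟ parent u
      ... | yes eq = eq
      ... | no pw≢pu
        with ∃-biconnected uw | ∃-biconnected pp′ | sideways-lev uw | sideways-lev pp′
      ... | S , bS , lowS , u∈S , _ , p∈S , top∈S | T , bT , lowT , p∈T , p′∈T , top∈T , _
          | d , lev-u | e , lev-p =
        contradiction (lev-step top~u) (ℕ.<⇒≱ (ℕ.≤-<-trans top<p p<u))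
        where
        p = parent u
        top = parent p
        left : ∀ {x} → x ∈ S → x ∈ S ∪ T
        left = x∈p∪q⁺ ∘ inj₁
        right : ∀ {x} → x ∈ T → x ∈ S ∪ T
        right = x∈p∪q⁺ {p = S} ∘ inj₂
        t∈S : top ∈ S
        t∈S = top∈S (pw≢pu ∘ sym)
        top<p : lev top < lev p
        top<p = below-parent lev-p
        p<u : lev p < lev u
        p<u = below-parent lev-u
        lev-p′ : lev p′ ≡ lev p
        lev-p′ = proj₂ pp′
        top~u : top ~ u
        -- The vertex with three neighbours is `p`, with `u` below it, `top` above it and `p′`
        -- beside it. The resulting edge from `top` to `u` would span two levels.
        top~u = 3-neighbours⇒clique
          (biconnected-∪ bS bT (levels-≢ top<p ∘ sym) p∈S p∈T t∈S top∈T)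
          (λ y∈ → ℕ.≤-trans ([ lowS , (λ y∈T → ℕ.≤-trans (lowT y∈T) (ℕ.<⇒≤ p<u)) ]′ (x∈p∪q⁻ S T y∈)) u≤r)
          (left p∈S) (left u∈S) (left t∈S) (right p′∈T)
          (levels-≢ (ℕ.<-trans top<p p<u) ∘ sym)
          (levels-≢ (subst (_< lev u) (sym lev-p′) p<u) ∘ sym)
          (levels-≢ (subst (lev top <_) (sym lev-p′) top<p))
          (~-sym (proj₁ (parent-upward lev-u))) (proj₁ (parent-upward lev-p)) (proj₁ pp′)
          (left t∈S) (left u∈S) (levels-≢ (ℕ.<-trans top<p p<u))

      downward-parent : ∀ {x y} → lev y ≤ r → Downward x y → parent y ≡ x
      downward-parent y≤r (x~y , eq) = sym (parent-unique y≤r (~-sym x~y , sym eq))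

      -- The 1 pays for the parent, the only neighbour above by `parent-unique`. At the root nothing
      -- lies above, hence an inequality.
      degree-split : ∀ {x} → lev x ≤ r → degree G x ≤ suc (length (children x) + length (same x))
      degree-split {x} x≤r = subst (degree G x ≤_) (cong suc (length-++ (children x)))
        (length-⊆ (select-unique (x ~?_)) split)
        where
        split : ∀ {y} → y ∈ˡ neighbours x → y ∈ˡ parent x ∷ children x ++ same x
        split y∈ with direction (∈-select⁻ (x ~?_) y∈)
        ... | inj₁ up          = here (parent-unique x≤r up)
        ... | inj₂ (inj₁ down) = there (∈-++⁺ˡ (∈-select⁺ (downward? x) down))
        ... | inj₂ (inj₂ side) = there (∈-++⁺ʳ (children x) (∈-select⁺ (sideways? x) side))

      -- Children, grandchildren and the growth of spheres.

      module _ (Δ : ℕ) (2≤Δ : 2 ≤ Δ) (degree≡Δ : ∀ {x} → lev x ≤ r → degree G x ≡ Δ)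
               (¬cycle : ¬ IsCycle G) (¬clique : ¬ IsClique G) where

        -- Without children, all edges at `u` except the one to its parent go sideways. For `3 ≤ Δ`
        -- these are at least two, so `sideways-clique` applies. For `Δ` equal to 2 only one is
        -- guaranteed, and the cycle that it closes is the whole graph.
        ∃-downward : ∀ {u} → lev u < r → ∃ (Downward u)
        ∃-downward {u} u<r with any? (downward? u)
        ... | yes found = found
        ... | no none   = contradiction (ℕ.m≤n⇒m<n∨m≡n 2≤Δ) [ ¬3≤Δ , ¬2≡Δ ]′
          where
          u≤r : lev u ≤ r
          u≤r = ℕ.<⇒≤ u<r
          childless : length (children u) ≤ 0
          childless = length-⊆ {ys = []} (select-unique (downward? u))
            λ y∈ → contradiction (_ , ∈-children⁻ y∈) none
          Δ≤1+same : Δ ≤ suc (length (same u))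
          Δ≤1+same = ℕ.≤-trans (ℕ.≤-reflexive (sym (degree≡Δ u≤r)))
            (ℕ.≤-trans (degree-split u≤r) (s≤s (ℕ.+-monoˡ-≤ (length (same u)) childless)))
          side : ∃ (Sideways u)
          side with ∃-∈ (s≤s⁻¹ (ℕ.≤-trans 2≤Δ Δ≤1+same))
          ... | y , y∈ = y , ∈-same⁻ y∈
          ¬2≡Δ : ¬ 2 ≡ Δ
          ¬2≡Δ 2≡Δ = ¬cycle (sideways-IsCycle (proj₂ side) λ x≤u →
            ℕ.≤-reflexive (trans (degree≡Δ (ℕ.≤-trans x≤u u≤r)) (sym 2≡Δ)))
          lev-u : ∃ λ d → lev u ≡ suc d
          lev-u = sideways-lev (proj₂ side)
          p<u : lev (parent u) < lev u
          p<u = below-parent (proj₂ lev-u)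
          K : List (Fin n)
          K = parent u ∷ u ∷ same u
          ¬3≤Δ : ¬ 3 ≤ Δ
          ¬3≤Δ 3≤Δ = ¬clique λ x y x≢y → K-adjacent (in-K x) (in-K y) x≢y
            where
            p~same : ∀ {y} → y ∈ˡ same u → parent u ~ y
            -- `sideways-clique` takes a pair of sideways neighbours; `3 ≤ Δ` supplies a partner `z`
            -- for `y`.
            p~same {y} y∈ with ∃-other (select-unique (sideways? u)) (s≤s⁻¹ (ℕ.≤-trans 3≤Δ Δ≤1+same)) y
            ... | z , z∈ , z≢y =
              ~-sym (proj₂ (sideways-clique u≤r (∈-same⁻ y∈) (∈-same⁻ z∈) (z≢y ∘ sym)))
            u~p : u ~ parent u
            u~p = proj₁ (parent-upward (proj₂ lev-u))
            K-adjacent : ∀ {x y} → x ∈ˡ K → y ∈ˡ K → x ≢ y → x ~ y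
            K-adjacent (here refl)         (here refl)         x≢y = contradiction refl x≢y
            K-adjacent (here refl)         (there (here refl)) _   = ~-sym u~p
            K-adjacent (here refl)         (there (there y∈))  _   = p~same y∈
            K-adjacent (there (here refl)) (here refl)         _   = u~p
            K-adjacent (there (here refl)) (there (here refl)) x≢y = contradiction refl x≢y
            K-adjacent (there (here refl)) (there (there y∈))  _   = proj₁ (∈-same⁻ y∈)
            K-adjacent (there (there x∈))  (here refl)         _   = ~-sym (p~same x∈)
            K-adjacent (there (there x∈))  (there (here refl)) _   = ~-sym (proj₁ (∈-same⁻ x∈))
            K-adjacent (there (there x∈))  (there (there y∈))  x≢y =
              proj₁ (sideways-clique u≤r (∈-same⁻ x∈) (∈-same⁻ y∈) x≢y)
            K-low : ∀ {x} → x ∈ˡ K → lev x ≤ r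
            K-low (here refl)         = ℕ.≤-trans (ℕ.<⇒≤ p<u) u≤r
            K-low (there (here refl)) = u≤r
            K-low (there (there x∈))  = ℕ.≤-trans (ℕ.≤-reflexive (proj₂ (∈-same⁻ x∈))) u≤r
            K-unique : Unique K
            K-unique =
              (levels-≢ p<u ∷ All.tabulate λ y∈ eq → ~-irrefl eq (p~same y∈)) ∷
              (All.tabulate λ y∈ eq → ~-irrefl eq (proj₁ (∈-same⁻ y∈))) ∷
              select-unique (sideways? u)
            K-closed : ∀ {x y} → x ∈ˡ K → x ~ y → y ∈ˡ K
            -- `K` has at least `suc Δ` members, all mutually adjacent, so degree `Δ` leaves no edge
            -- out of `K`.
            K-closed {x} x∈ = full-neighbours K-unique near
              (s≤s (ℕ.≤-trans (ℕ.≤-reflexive (degree≡Δ (K-low x∈))) Δ≤1+same))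
              where
              near : ∀ {z} → z ∈ˡ K → z ≡ x ⊎ x ~ z
              near {z} z∈ with z ≟ x
              ... | yes z≡x = inj₁ z≡x
              ... | no z≢x  = inj₂ (K-adjacent x∈ z∈ (z≢x ∘ sym))
            in-K : ∀ x → x ∈ˡ K
            in-K x = walk-closed (_∈ˡ K) K-closed (proj₂ (connected u x)) (there (here refl))

        -- One chosen child per vertex. Below level `r`, `parent` recovers the vertex, so distinct
        -- vertices receive distinct children.
        child : Fin n → Fin n
        child x with any? (downward? x)
        ... | yes (y , _) = y
        ... | no _        = x

        child-downward : ∀ {x} → lev x < r → Downward x (child x)
        child-downward {x} x<r with any? (downward? x)
        ... | yes (_ , down) = down
        ... | no none        = contradiction (∃-downward x<r) none

        parent-child : ∀ {x} → lev x < r → parent (child x) ≡ x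
        parent-child x<r = downward-parent
          (ℕ.≤-trans (ℕ.≤-reflexive (proj₂ (child-downward x<r))) x<r) (child-downward x<r)

        -- Stated through `parent`, so that different `p` have disjoint sets of grandchildren. The
        -- level condition discards the root and its children, for which `parent ∘ parent` involves
        -- the default value or stops at the root.
        Grandchild : Fin n → Fin n → Set
        Grandchild p y = lev y ≡ 2 + lev p × parent (parent y) ≡ p

        grandchild? : ∀ p → Decidable (Grandchild p)
        grandchild? p y = (lev y ℕ.≟ 2 + lev p) ×-dec (parent (parent y) ≟ p)

        grandchildren : Fin n → List (Fin n)
        grandchildren p = select (grandchild? p)

        -- If p has no neighbour on its own level then it has at least Δ ∸ 1 children, each of
        -- which has a child.  Otherwise all sideways neighbours of a child u of p are children
        -- of p, and taking one child of each of them makes up for the edges missing below u.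
        grandchildren-bound : ∀ {p} → 2 + lev p ≤ r → Δ ∸ 1 ≤ length (grandchildren p)
        grandchildren-bound {p} p+2≤r with any? (sideways? p)
        ... | no none = ℕ.≤-trans Δ-1≤children (subst (_≤ length (grandchildren p))
          (length-map child (children p)) (length-⊆ (map-unique child parent inverse (select-unique (downward? p))) grand))
          where
          p<r : lev p < r
          p<r = ℕ.<⇒≤ p+2≤r
          no-same : length (same p) ≤ 0
          no-same = length-⊆ {ys = []} (select-unique (sideways? p))
            λ y∈ → contradiction (_ , ∈-same⁻ y∈) none
          Δ-1≤children : Δ ∸ 1 ≤ length (children p)
          Δ-1≤children = ℕ.∸-monoˡ-≤ 1 (ℕ.≤-trans (ℕ.≤-reflexive (sym (degree≡Δ (ℕ.<⇒≤ p<r))))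
            (ℕ.≤-trans (degree-split (ℕ.<⇒≤ p<r)) (s≤s (ℕ.≤-trans
              (ℕ.+-monoʳ-≤ (length (children p)) no-same) (ℕ.≤-reflexive (ℕ.+-identityʳ _))))))
          child<r : ∀ {y} → y ∈ˡ children p → lev y < r
          child<r y∈ = ℕ.≤-trans (s≤s (ℕ.≤-reflexive (proj₂ (∈-children⁻ y∈)))) p+2≤r
          inverse : ∀ {y} → y ∈ˡ children p → parent (child y) ≡ y
          inverse y∈ = parent-child (child<r y∈)
          grand : ∀ {y} → y ∈ˡ map child (children p) → y ∈ˡ grandchildren p
          grand y∈ with ∈-map⁻ child y∈
          ... | u , u∈ , refl = ∈-select⁺ (grandchild? p)
            ( trans (proj₂ (child-downward (child<r u∈))) (cong suc (proj₂ (∈-children⁻ u∈)))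
            , trans (cong parent (inverse u∈)) (downward-parent (ℕ.<⇒≤ (child<r u∈)) (∈-children⁻ u∈)))
        ... | yes (p′ , side) = ℕ.≤-trans Δ-1≤ (subst (_≤ length (grandchildren p)) length-list
          (length-⊆ list-unique grand))
          where
          p<r : lev p < r
          p<r = ℕ.<⇒≤ p+2≤r
          u = child p
          lev-u : lev u ≡ suc (lev p)
          lev-u = proj₂ (child-downward p<r)
          parent-u : parent u ≡ p
          parent-u = parent-child p<r
          u<r : lev u < r
          u<r = ℕ.≤-trans (s≤s (ℕ.≤-reflexive lev-u)) p+2≤r
          list : List (Fin n)
          list = children u ++ map child (same u)
          length-list : length list ≡ length (children u) + length (same u)
          length-list = trans (length-++ (children u)) (cong (length (children u) +_) (length-map child (same u)))
          Δ-1≤ : Δ ∸ 1 ≤ length (children u) + length (same u)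
          Δ-1≤ = ℕ.∸-monoˡ-≤ 1 (ℕ.≤-trans (ℕ.≤-reflexive (sym (degree≡Δ (ℕ.<⇒≤ u<r)))) (degree-split (ℕ.<⇒≤ u<r)))
          same<r : ∀ {y} → y ∈ˡ same u → lev y < r
          same<r y∈ = ℕ.≤-<-trans (ℕ.≤-reflexive (proj₂ (∈-same⁻ y∈))) u<r
          inverse : ∀ {y} → y ∈ˡ same u → parent (child y) ≡ y
          inverse y∈ = parent-child (same<r y∈)
          child-parent : ∀ {y} → y ∈ˡ children u → parent y ≡ u
          child-parent y∈ = downward-parent
            (ℕ.≤-trans (ℕ.≤-reflexive (proj₂ (∈-children⁻ y∈))) u<r) (∈-children⁻ y∈)
          list-unique : Unique list
          list-unique = ++⁺ (select-unique (downward? u))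
            (map-unique child parent inverse (select-unique (sideways? u))) disjoint
            where
            disjoint : ∀ {y} → ¬ (y ∈ˡ children u × y ∈ˡ map child (same u))
            -- A common element would have both `u` and its neighbour `s` as parent.
            disjoint (y∈ , y∈′) with ∈-map⁻ child y∈′
            ... | s , s∈ , refl =
              ~-irrefl (trans (sym (child-parent y∈)) (inverse s∈)) (proj₁ (∈-same⁻ s∈))
          grand : ∀ {y} → y ∈ˡ list → y ∈ˡ grandchildren p
          grand y∈ with ∈-++⁻ (children u) y∈
          ... | inj₁ y∈c = ∈-select⁺ (grandchild? p)
            ( trans (proj₂ (∈-children⁻ y∈c)) (cong suc lev-u)
            , trans (cong parent (child-parent y∈c)) parent-u)
          ... | inj₂ y∈s with ∈-map⁻ child y∈s
          ...   | s , s∈ , refl = ∈-select⁺ (grandchild? p)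
            ( trans (proj₂ (child-downward (same<r s∈))) (cong suc (trans (proj₂ (∈-same⁻ s∈)) lev-u))
            , trans (cong parent (inverse s∈)) (trans
                -- The sideways neighbour `p′` of `p` is what forces `s` to share the parent of `u`.
                (sideways-siblings (ℕ.<⇒≤ u<r) (subst (λ q → Sideways q p′) (sym parent-u) side) (∈-same⁻ s∈))
                parent-u))

        sphere-growth : ∀ d → 2 + d ≤ r → (Δ ∸ 1) * length (sphere G v d) ≤ length (sphere G v (2 + d))
        sphere-growth d d+2≤r = ℕ.≤-trans (proj₂ fibres) (length-⊆ (proj₁ fibres) sub)
          where
          on-sphere : ∀ {x} → x ∈ˡ sphere G v d → lev x ≡ d
          on-sphere {x} x∈ = distance-unique (lev-distance x) (∈-select⁻ (λ x → distance? G v x d) x∈)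
          fibres : Unique (concatMap grandchildren (sphere G v d)) ×
                   (Δ ∸ 1) * length (sphere G v d) ≤ length (concatMap grandchildren (sphere G v d))
          fibres = concatMap-fibres (parent ∘ parent) grandchildren (Δ ∸ 1)
            (select-unique (λ x → distance? G v x d))
            (λ {x} x∈ → select-unique (grandchild? x)
                      , grandchildren-bound (subst (λ k → 2 + k ≤ r) (sym (on-sphere x∈)) d+2≤r)
                      , proj₂ ∘ ∈-select⁻ (grandchild? x))
          sub : ∀ {y} → y ∈ˡ concatMap grandchildren (sphere G v d) → y ∈ˡ sphere G v (2 + d)
          sub {y} y∈ with find (∈-concatMap⁻ grandchildren {xs = sphere G v d} y∈)
          ... | x , x∈ , y∈x = ∈-select⁺ (λ x → distance? G v x (2 + d))
            (subst (Distance G v y)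
              (trans (proj₁ (∈-select⁻ (grandchild? x) y∈x)) (cong (2 +_) (on-sphere x∈)))
              (lev-distance y))

  -- Iterating the growth two levels at a time.

  1≤sphere₀ : ∀ v → 1 ≤ length (sphere G v 0)
  1≤sphere₀ v = ∈-length (∈-select⁺ (λ x → distance? G v x 0) ([] , λ ()))

lemma17 : ∀ {n} (G : Graph (Fin n)) → Nice G →
    (r : ℕ) → 2 ∣ r → (v : Fin n) →
    ¬ (∃ λ (S : Subset n) → IsDCC G S × (∀ x → x ∈ S → Ball G v r x)) →
    (∀ x → Ball G v r x → degree G x ≡ maxDegree G) →
    (maxDegree G ∸ 1) ^ (r / 2) ≤ length (sphere G v r)
lemma17 {n} G (connected , _ , ¬cycle , ¬clique) _ (divides q refl) v ¬dcc degree≡Δ =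
  subst (λ i → (Δ ∸ 1) ^ i ≤ length (sphere G v (q * 2))) (sym (m*n/n≡m q 2)) (bound (2 ℕ.≤? Δ) q ℕ.≤-refl)
  where
  Δ = maxDegree G
  in-ball : ∀ {x} → lev G connected v x ≤ q * 2 → Ball G v (q * 2) x
  in-ball {x} x≤r = _ , x≤r , lev-distance G connected v x
  bound : Dec (2 ≤ Δ) → ∀ i → i * 2 ≤ q * 2 → (Δ ∸ 1) ^ i ≤ length (sphere G v (i * 2))
  bound _         zero    _   = 1≤sphere₀ G v
  -- Here the base `Δ ∸ 1` is zero, and so is its positive power.
  bound (no 2≰Δ)  (suc i) _
    rewrite ℕ.m≤n⇒m∸n≡0 (s≤s⁻¹ (ℕ.≰⇒> 2≰Δ)) = z≤n
  bound (yes 2≤Δ) (suc i) i≤q = ℕ.≤-trans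
    (ℕ.*-monoʳ-≤ (Δ ∸ 1) (bound (yes 2≤Δ) i (ℕ.≤-trans (ℕ.m≤n+m (i * 2) 2) i≤q)))
    (sphere-growth G connected v (q * 2)
      (λ S dcc low → ¬dcc (S , dcc , λ x x∈ → in-ball (low x x∈)))
      Δ 2≤Δ (λ x≤r → degree≡Δ _ (in-ball x≤r)) ¬cycle ¬clique (i * 2) i≤q)
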